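{- For the bounded buffer model, the deterministic online algorithm GRQ is $2$-competitive.
   Context: Bounded buffer model. Time is discrete, with time steps $1,2,3,\ldots$. There is one buffer of size $B\in\mathbb{Z}^+$: at any time it can store at most $B$ packets. Packets arrive over time; within a time step, the arrivals (any number, one after another) occur first and then at most one packet from the buffer can be sent. Each packet $p$ has a release (arrival) time, a non-negative value $v_p$ and an integer deadline $d_p\in\mathbb{Z}^+$; it contributes its value only if it is sent in a time step no later than $d_p$ (sending in step $d_p$ is allowed). On arrival a packet is either accepted into the buffer or rejected; packets in the buffer may be dropped at any time before they are sent. A rejected or dropped packet cannot be delivered any more. The weighted throughput of a schedule is the total value of the packets sent by their respective deadlines; the objective is to maximize it. An online algorithm makes its decisions knowing only the packets that have arrived so far. Competitive ratio. A deterministic online algorithm is $k$-competitive if on every finite instance its weighted throughput is at least $1/k$ times the weighted throughput of an optimal offline algorithm (which knows the whole instance in advance) on that instance. Algorithm GRQ. Let the buffer slots be $S[1],S[2],\ldots,S[B]$; at time $t$, slot $S[i]$ corresponds to sending a packet in time step $t+i-1$ in the current provisional schedule. At each time $t$, GRQ does the following. (1) Align the packets in the buffer slots in non-increasing value order: the pending packets (those in the buffer and the new arrivals) are considered in non-increasing order of value, and each packet $j$ is put in the first available (not yet occupied) buffer slot $S[i]$; if $j$ cannot be scheduled in time step $t+i-1$ (i.e. $d_j<t+i-1$), or if no slot is available, $j$ is dropped. (2) Send the first packet, i.e. the packet in $S[1]$ (if any).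
   Formalization: Ties among packets of equal value are broken by an arbitrary total order on packets that is fixed over time; if ties may be reordered between time steps, GRQ is not 2-competitive. Values lie in any ordered field with decidable order (classically including the reals). -}

module Defs where

open import Algebra.Bundles using (CommutativeRing)
open import Data.List.Base
  using (List; []; _∷_; _++_; length; filter; foldr; catMaybes; fromMaybe)
open import Data.List.Properties using (length-catMaybes; length-++; ++-assoc; ++-identityʳ)
open import Data.List.Relation.Binary.Permutation.Propositional
  using (_↭_; ↭-refl; ↭-sym; ↭-trans; ↭-prep; ↭-swap; ↭-reflexive)
open import Data.List.Relation.Binary.Permutation.Propositional.Properties
  using (∈-resp-↭; drop-∷; shift; ++⁺ʳ; ++⁺ˡ; ++-comm; ↭-length)
open import Data.List.Membership.Propositional using (_∈_)
open import Data.List.Membership.Propositional.Properties using (∈-∃++; ∈-++⁻)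
open import Data.List.Relation.Unary.Any using (here)
import Data.List.Sort as Sort
open import Data.Maybe.Base using (Maybe; just; nothing)
open import Data.Nat.Base as ℕ using (ℕ; zero; suc)
import Data.Nat.Properties as ℕ
open import Data.Product.Base using (∃-syntax; _×_; _,_)
open import Data.Sum.Base using (inj₁; inj₂)
open import Data.Vec.Base using (Vec; []; _∷_; replicate; toList)
open import Data.Vec.Properties using (length-toList)
open import Level using (Level; _⊔_) renaming (suc to lsuc)
open import Relation.Binary.Bundles using (DecTotalOrder)
open import Relation.Binary.Core using (Rel)
open import Relation.Binary.PropositionalEquality
  using (_≡_; refl; sym; trans; cong; cong₂; subst)
open import Relation.Binary.Structures using (IsDecTotalOrder)
open import Relation.Nullary using (¬_; yes; no)

-- Packet values live in an arbitrary ordered field whose order is decidable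
-- (GRQ has to compare values); the standard library has no real numbers.
record OrderedField c ℓ₁ ℓ₂ : Set (lsuc (c ⊔ ℓ₁ ⊔ ℓ₂)) where
  field
    commutativeRing : CommutativeRing c ℓ₁
  open CommutativeRing commutativeRing public
  infix 4 _≤_
  infix 8 _⁻¹
  field
    _≤_             : Rel Carrier ℓ₂
    isDecTotalOrder : IsDecTotalOrder _≈_ _≤_
    +-monoʳ-≤       : ∀ z {x y} → x ≤ y → z + x ≤ z + y
    *-nonNegative   : ∀ {x y} → 0# ≤ x → 0# ≤ y → 0# ≤ x * y
    1≉0             : ¬ 1# ≈ 0#
    -- Total, with an unspecified value at 0#.
    _⁻¹             : Carrier → Carrier
    *-inverseʳ      : ∀ x → ¬ x ≈ 0# → x * x ⁻¹ ≈ 1#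

module BoundedBuffer {c ℓ₁ ℓ₂} (F : OrderedField c ℓ₁ ℓ₂) where
  open OrderedField F
    using (Carrier; _≈_; _≤_; _+_; _*_; 0#; 1#; _⁻¹)

  -- The label plays no role in the model.  It lets tie-breaking rules tell
  -- apart packets that are otherwise alike (it may, for instance, record the
  -- position in the arrival sequence).
  record Packet : Set (c ⊔ ℓ₂) where
    field
      label         : ℕ
      release       : ℕ
      value         : Carrier
      deadline      : ℕ
      .{{release≢0}}  : ℕ.NonZero release
      .{{deadline≢0}} : ℕ.NonZero deadline
      value≥0       : 0# ≤ value
  open Packet public

  -- Packets released in the same step arrive in list order.
  Instance : Set (c ⊔ ℓ₂)
  Instance = List Packet

  arrivals : Instance → ℕ → List Packet
  arrivals σ t = filter (λ p → release p ℕ.≟ t) σ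

  -- Arrival phase of one step for a buffer of size B: `Admit B b ps b′` says
  -- that, while the packets ps arrive one after another, the buffer contents
  -- can evolve from b to b′ by accepting or rejecting each arrival and by
  -- dropping stored packets at any moment.  Contents are multisets.
  data Admit (B : ℕ) : List Packet → List Packet → List Packet → Set (c ⊔ ℓ₂) where
    done   : ∀ {b b′} → b ↭ b′ → Admit B b [] b′
    accept : ∀ {b b′ p ps} → suc (length b) ℕ.≤ B →
             Admit B (p ∷ b) ps b′ → Admit B b (p ∷ ps) b′
    reject : ∀ {b b′ p ps} → Admit B b ps b′ → Admit B b (p ∷ ps) b′
    drop   : ∀ {b d b′ p ps} → b ↭ p ∷ d → Admit B d ps b′ → Admit B b ps b′

  -- `buffer t` is the content between the arrivals and the sending of step t,
  -- `left t` the content at the end of step t.  Steps are numbered from 1;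
  -- `left 0` is the initial content, `buffer 0` and `sent 0` are irrelevant.
  record Schedule (B : ℕ) (σ : Instance) : Set (c ⊔ ℓ₂) where
    field
      buffer : ℕ → List Packet
      sent   : ℕ → Maybe Packet
      left   : ℕ → List Packet
      start  : left 0 ≡ []
      admit  : ∀ t → Admit B (left t) (arrivals σ (suc t)) (buffer (suc t))
      send   : ∀ t → buffer (suc t) ↭ fromMaybe (sent (suc t)) ++ left (suc t)
  open Schedule public

  gain : ℕ → Maybe Packet → Carrier
  gain t nothing  = 0#
  gain t (just p) with t ℕ.≤? deadline p
  ... | yes _ = value p
  ... | no  _ = 0#

  gainUpTo : (ℕ → Maybe Packet) → ℕ → Carrier
  gainUpTo s zero    = 0#
  gainUpTo s (suc t) = gainUpTo s t + gain (suc t) (s (suc t))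

  -- No packet contributes after the latest deadline, so summing the gains up
  -- to that step yields the throughput of the whole, infinite, schedule.
  horizon : Instance → ℕ
  horizon = foldr (λ p t → deadline p ℕ.⊔ t) 0

  throughput : ∀ {B σ} → Schedule B σ → Carrier
  throughput {σ = σ} S = gainUpTo (sent S) (horizon σ)

  record OnlineAlgorithm (B : ℕ) : Set (c ⊔ ℓ₂) where
    field
      run    : ∀ σ → Schedule B σ
      online : ∀ {σ τ} t →
               (∀ s → s ℕ.≤ suc t → arrivals σ s ≡ arrivals τ s) →
               buffer (run σ) (suc t) ≡ buffer (run τ) (suc t) ×
               sent (run σ) (suc t) ≡ sent (run τ) (suc t) ×
               left (run σ) (suc t) ≡ left (run τ) (suc t)
  open OnlineAlgorithm public

  -- The schedules of σ are what an offline algorithm can choose from, so the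
  -- bound for an optimal one is the bound for all of them.
  Competitive : ∀ {B} → Carrier → OnlineAlgorithm B → Set (c ⊔ ℓ₂)
  Competitive {B} k A =
    ∀ σ (opt : Schedule B σ) → k ⁻¹ * throughput opt ≤ throughput (run A σ)

  -- The order in which GRQ considers packets: non-increasing in value, with
  -- ties broken by an arbitrary rule.  The rule must not change over time:
  -- if equally valuable packets may be reordered from one step to the next,
  -- GRQ is not 2-competitive.
  record Priority r : Set (c ⊔ ℓ₁ ⊔ ℓ₂ ⊔ lsuc r) where
    _≐_ : Rel Packet ℓ₁
    p ≐ q = value p ≈ value q × deadline p ≡ deadline q ×
            release p ≡ release q × label p ≡ label q
    infix 4 _≼_
    field
      _≼_             : Rel Packet r
      isDecTotalOrder : IsDecTotalOrder _≐_ _≼_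
      ≼⇒value≥        : ∀ {p q} → p ≼ q → value q ≤ value p

    decTotalOrder : DecTotalOrder (c ⊔ ℓ₂) ℓ₁ r
    decTotalOrder = record { isDecTotalOrder = isDecTotalOrder }

  Slots : ℕ → Set (c ⊔ ℓ₂)
  Slots = Vec (Maybe Packet)

  -- Put a packet in the first free slot, the first slot of the vector standing
  -- for time step t, unless it would miss its deadline there.
  place : ∀ {n} → ℕ → Packet → Slots n → Slots n
  place t p []             = []
  place t p (just q  ∷ ss) = just q ∷ place (suc t) p ss
  place t p (nothing ∷ ss) with t ℕ.≤? deadline p
  ... | yes _ = just p ∷ ss
  ... | no  _ = nothing ∷ ss

  placeAll : ∀ {n} → ℕ → List Packet → Slots n → Slots n
  placeAll t []       ss = ss
  placeAll t (p ∷ ps) ss = placeAll t ps (place t p ss)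

  contents : ∀ {n} → Slots n → List Packet
  contents ss = catMaybes (toList ss)

  firstSlot : ∀ {n} → Slots n → Maybe Packet
  firstSlot []       = nothing
  firstSlot (s ∷ ss) = s

  otherSlots : ∀ {n} → Slots n → List Packet
  otherSlots []       = []
  otherSlots (s ∷ ss) = contents ss

  ∈⇒↭ : ∀ {p : Packet} {xs} → p ∈ xs → ∃[ ys ] xs ↭ p ∷ ys
  ∈⇒↭ p∈xs with ∈-∃++ p∈xs
  ... | us , vs , refl = us ++ vs , shift _ us vs

  split : ∀ {K D : List Packet} C {A} → K ++ D ↭ C ++ A →
          ∃[ K₁ ] ∃[ K₂ ] ∃[ D₁ ] ∃[ D₂ ]
          K ↭ K₁ ++ K₂ × C ↭ D₁ ++ K₁ × A ↭ K₂ ++ D₂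
  split {K} {D} [] eq =
    [] , K , [] , D , ↭-refl , ↭-refl , ↭-sym eq
  split {K} {D} (p ∷ C) eq
    with ∈-++⁻ K (∈-resp-↭ (↭-sym eq) (here refl))
  ... | inj₁ p∈K with ∈⇒↭ p∈K
  ...   | K′ , K↭ with split {K′} {D} C (drop-∷ (↭-trans (↭-sym (++⁺ʳ D K↭)) eq))
  ...     | K₁ , K₂ , D₁ , D₂ , e₁ , e₂ , e₃ =
    p ∷ K₁ , K₂ , D₁ , D₂ , ↭-trans K↭ (↭-prep p e₁) ,
    ↭-trans (↭-prep p e₂) (↭-sym (shift p D₁ K₁)) , e₃
  split {K} {D} (p ∷ C) eq | inj₂ p∈D with ∈⇒↭ p∈D
  ...   | D′ , D↭
    with split {K} {D′} C
           (drop-∷ (↭-trans (↭-sym (↭-trans (++⁺ˡ K D↭) (shift p K D′))) eq))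
  ...     | K₁ , K₂ , D₁ , D₂ , e₁ , e₂ , e₃ =
    K₁ , K₂ , p ∷ D₁ , D₂ , e₁ , ↭-prep p e₂ , e₃

  Admit-respˡ : ∀ {B b d ps b′} → b ↭ d → Admit B d ps b′ → Admit B b ps b′
  Admit-respˡ eq (done e)     = done (↭-trans eq e)
  Admit-respˡ eq (accept l a) =
    accept (subst (λ n → suc n ℕ.≤ _) (sym (↭-length eq)) l)
           (Admit-respˡ (↭-prep _ eq) a)
  Admit-respˡ eq (reject a)   = reject (Admit-respˡ eq a)
  Admit-respˡ eq (drop e a)   = drop (↭-trans eq e) a

  Admit-respʳ : ∀ {B b ps d b′} → d ↭ b′ → Admit B b ps d → Admit B b ps b′
  Admit-respʳ eq (done e)     = done (↭-trans e eq)
  Admit-respʳ eq (accept l a) = accept l (Admit-respʳ eq a)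
  Admit-respʳ eq (reject a)   = reject (Admit-respʳ eq a)
  Admit-respʳ eq (drop e a)   = drop e (Admit-respʳ eq a)

  dropAll : ∀ {B b d ps b′} D → b ↭ D ++ d → Admit B d ps b′ → Admit B b ps b′
  dropAll []      eq a = Admit-respˡ eq a
  dropAll (p ∷ D) eq a = drop eq (dropAll D ↭-refl a)

  acceptAll : ∀ {B b K D} A → A ↭ K ++ D → length (K ++ b) ℕ.≤ B →
              Admit B b A (K ++ b)
  acceptAll {K = []}    [] eq l = done ↭-refl
  acceptAll {K = p ∷ K} [] eq l with ↭-length eq
  ... | ()
  acceptAll {B} {b} {K} {D} (p ∷ A) eq l with ∈-++⁻ K (∈-resp-↭ eq (here refl))
  ... | inj₂ p∈D with ∈⇒↭ p∈D
  ...   | D′ , D↭ =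
    reject (acceptAll A (drop-∷ (↭-trans eq (↭-trans (++⁺ˡ K D↭) (shift p K D′)))) l)
  acceptAll {B} {b} {K} {D} (p ∷ A) eq l | inj₁ p∈K with ∈⇒↭ p∈K
  ...   | K′ , K↭ =
    accept (ℕ.≤-trans (ℕ.s≤s len) l′)
      (Admit-respʳ (↭-trans (shift p K′ b) (++⁺ʳ b (↭-sym K↭)))
        (acceptAll A (drop-∷ (↭-trans eq (++⁺ʳ D K↭)))
          (subst (ℕ._≤ B) (sym (↭-length (shift p K′ b))) l′)))
    where
    l′ : suc (length (K′ ++ b)) ℕ.≤ B
    l′ = subst (ℕ._≤ B) (↭-length (++⁺ʳ b K↭)) l

    len : length b ℕ.≤ length (K′ ++ b)
    len = subst (length b ℕ.≤_) (sym (length-++ K′)) (ℕ.m≤n+m _ _)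

  admissible : ∀ {B K D} C {A} → K ++ D ↭ C ++ A → length K ℕ.≤ B → Admit B C A K
  admissible {B} C {A} eq l with split C eq
  ... | K₁ , K₂ , D₁ , D₂ , e₁ , e₂ , e₃ =
    dropAll D₁ e₂
      (Admit-respʳ (↭-sym e) (acceptAll A e₃ (subst (ℕ._≤ B) (↭-length e) l)))
    where e = ↭-trans e₁ (++-comm K₁ K₂)

  contents-length : ∀ {n} (ss : Slots n) → length (contents ss) ℕ.≤ n
  contents-length ss =
    ℕ.≤-trans (length-catMaybes (toList ss)) (ℕ.≤-reflexive (length-toList ss))

  contents-empty : ∀ n → contents (replicate n nothing) ≡ []
  contents-empty zero    = refl
  contents-empty (suc n) = contents-empty n

  contents-first : ∀ {n} (ss : Slots n) →
                   contents ss ≡ fromMaybe (firstSlot ss) ++ otherSlots ss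
  contents-first []             = refl
  contents-first (just p  ∷ ss) = refl
  contents-first (nothing ∷ ss) = refl

  place-↭ : ∀ {n} t p (ss : Slots n) →
            ∃[ D ] contents (place t p ss) ++ D ↭ p ∷ contents ss
  place-↭ t p []            = p ∷ [] , ↭-refl
  place-↭ t p (just q ∷ ss) with place-↭ (suc t) p ss
  ... | D , e = D , ↭-trans (↭-prep q e) (↭-swap q p ↭-refl)
  place-↭ t p (nothing ∷ ss) with t ℕ.≤? deadline p
  ... | yes _ = [] , ↭-reflexive (++-identityʳ (p ∷ contents ss))
  ... | no  _ = p ∷ [] , ++-comm (contents ss) (p ∷ [])

  placeAll-↭ : ∀ {n} t ps (ss : Slots n) →
               ∃[ D ] contents (placeAll t ps ss) ++ D ↭ ps ++ contents ss
  placeAll-↭ t []       ss = [] , ↭-reflexive (++-identityʳ _)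
  placeAll-↭ t (p ∷ ps) ss with place-↭ t p ss | placeAll-↭ t ps (place t p ss)
  ... | D , e | D′ , e′ = D′ ++ D ,
    ↭-trans (↭-reflexive (sym (++-assoc _ D′ D)))
    (↭-trans (++⁺ʳ D e′)
    (↭-trans (↭-reflexive (++-assoc ps _ D))
    (↭-trans (++⁺ˡ ps e) (shift p ps (contents ss)))))

  module GRQAlgorithm {r} (B : ℕ) (priority : Priority r) where
    open Sort (Priority.decTotalOrder priority) using (sort; sort-↭)

    -- The provisional schedule of step t, given the packets kept from the
    -- previous step and the new arrivals.
    align : ℕ → List Packet → List Packet → Slots B
    align t old new = placeAll t (sort (old ++ new)) (replicate B nothing)

    mutual
      slots : Instance → ℕ → Slots B
      slots σ zero    = replicate B nothing
      slots σ (suc t) = align (suc t) (rest σ t) (arrivals σ (suc t))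

      rest : Instance → ℕ → List Packet
      rest σ zero    = []
      rest σ (suc t) = otherSlots (slots σ (suc t))

    align-admit : ∀ t old new → Admit B old new (contents (align t old new))
    align-admit t old new with placeAll-↭ t (sort (old ++ new)) (replicate B nothing)
    ... | D , e = admissible old
      (↭-trans e (↭-trans
        (↭-reflexive (trans (cong (sort (old ++ new) ++_) (contents-empty B))
                            (++-identityʳ _)))
        (sort-↭ (old ++ new))))
      (contents-length (align t old new))

    schedule : ∀ σ → Schedule B σ
    schedule σ = record
      { buffer = λ t → contents (slots σ t)
      ; sent   = λ t → firstSlot (slots σ t)
      ; left   = rest σ
      ; start  = refl
      ; admit  = λ t → align-admit (suc t) (rest σ t) (arrivals σ (suc t))
      ; send   = λ t → ↭-reflexive (contents-first (slots σ (suc t)))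
      }

    slots-online : ∀ {σ τ} t → (∀ s → s ℕ.≤ t → arrivals σ s ≡ arrivals τ s) →
                   slots σ t ≡ slots τ t
    slots-online zero          eq = refl
    slots-online (suc zero)    eq = cong (align 1 []) (eq 1 ℕ.≤-refl)
    slots-online (suc (suc t)) eq =
      cong₂ (align (2 ℕ.+ t))
        (cong otherSlots (slots-online (suc t) (λ s s≤ → eq s (ℕ.m≤n⇒m≤1+n s≤))))
        (eq (2 ℕ.+ t) ℕ.≤-refl)

    GRQ : OnlineAlgorithm B
    GRQ = record
      { run    = schedule
      ; online = λ t eq → let e = slots-online (suc t) eq in
                 cong contents e , cong firstSlot e , cong otherSlots e
      }

  open GRQAlgorithm public using (GRQ)

{-# OPTIONS --safe #-}
-- Call a packet big if its value is at least a threshold v.  For every v, an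
-- arbitrary schedule delivers at most twice as many big packets as GRQ, and
-- summing over all thresholds bounds the total values.
--
-- To see this, note that a step reserved for a big packet in GRQ's provisional
-- schedule stays so, because the kept packets remain feasible when new ones are
-- merged in.  Big packets the opponent sends while GRQ does so are paid for by
-- GRQ's simultaneous packet.  One it sends at another step was released during
-- a maximal run of steps in which GRQ sends big packets and is still stored
-- when the run ends.  GRQ never drops it for its deadline, as the run would then
-- last beyond that deadline.  Either GRQ's buffer overflows with big packets, so
-- the run has length at least B, which bounds what the opponent stores, or GRQ
-- sends that very packet within the run.
module Submission where

open import Defs
open import Algebra.Bundles using (CommutativeRing)
import Algebra.Properties.Ring as RingProperties
open import Data.List.Base using (List; []; _∷_; _++_; length; filter; foldr; fromMaybe)
open import Data.List.Properties
  using (filter-accept; filter-reject; filter-none; filter-++; length-filter; length-++)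
open import Data.List.Membership.Propositional using (_∈_)
open import Data.List.Membership.Propositional.Properties using (∈-++⁻; ∈-filter⁻)
open import Data.List.Relation.Binary.Permutation.Propositional
  using (_↭_; ↭-refl; ↭-sym; ↭-trans; ↭-prep; prep; swap)
  renaming (refl to refl-↭; trans to trans-↭)
open import Data.List.Relation.Binary.Permutation.Propositional.Properties
  using (∈-resp-↭; All-resp-↭; drop-∷; shift; ++⁺ˡ; ++⁺ʳ; ↭-length; filter-↭)
open import Data.List.Relation.Binary.Sublist.Propositional using (_⊆_; []; _∷_; _∷ʳ_)
open import Data.List.Relation.Binary.Sublist.Propositional.Properties using (All-resp-⊆)
open import Data.List.Relation.Unary.All as All using (All; []; _∷_)
open import Data.List.Relation.Unary.AllPairs using (AllPairs; []; _∷_)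
open import Data.List.Relation.Unary.Any using (here)
import Data.List.Relation.Unary.Sorted.TotalOrder.Properties as Sorted
import Data.List.Sort as Sort
open import Data.Maybe.Base using (Maybe; just; nothing)
open import Data.Nat.Base as Nat using (ℕ; zero; suc; _<_; z≤n; s≤s; NonZero)
open import Data.Nat.Properties using
  ( _≤?_; _<?_; ≤-refl; ≤-reflexive; ≤-trans; ≤-<-trans; ≤-pred; ≮⇒≥; n≤1+n; m≤n⇒m≤1+n
  ; m≤m+n; m≤n+m; m+n≤o⇒m≤o; +-suc; +-comm; +-assoc; +-identityʳ
  ; +-mono-≤; +-monoˡ-≤; +-monoʳ-≤; module ≤-Reasoning)
open import Data.Nat.Tactic.RingSolver using (solve-∀)
open import Data.Product.Base using (∃-syntax; _×_; _,_; proj₁; proj₂)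
open import Data.Sum.Base using (_⊎_; inj₁; inj₂)
open import Data.Vec.Base using ([]; _∷_; replicate)
open import Function.Base using (_∘_)
open import Relation.Binary.Bundles using (DecTotalOrder; Poset)
open import Relation.Binary.PropositionalEquality
  using (_≡_; refl; sym; trans; cong; subst)
import Relation.Binary.Reasoning.PartialOrder as PosetReasoning
open import Relation.Binary.Structures using (IsDecTotalOrder)
open import Relation.Nullary using (¬_; Dec; yes; no; contradiction; _×-dec_)
open import Relation.Unary using (Pred; Decidable)

-- Counting list elements that satisfy a decidable predicate.

module _ {a p} {A : Set a} {P : Pred A p} (P? : Decidable P) where

  open Nat using (_+_; _≤_)

  count : List A → ℕ
  count xs = length (filter P? xs)

  count-accept : ∀ {x xs} → P x → count (x ∷ xs) ≡ suc (count xs)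
  count-accept px = cong length (filter-accept P? px)

  count-reject : ∀ {x xs} → ¬ P x → count (x ∷ xs) ≡ count xs
  count-reject ¬px = cong length (filter-reject P? ¬px)

  count-∷-≤ : ∀ x xs → count (x ∷ xs) ≤ suc (count xs)
  count-∷-≤ x xs with P? x
  ... | yes _ = ≤-refl
  ... | no  _ = n≤1+n _

  count-≤-∷ : ∀ x xs → count xs ≤ count (x ∷ xs)
  count-≤-∷ x xs with P? x
  ... | yes _ = n≤1+n _
  ... | no  _ = ≤-refl

  count-cong-∷ : ∀ x {xs ys} → count xs ≤ count ys → count (x ∷ xs) ≤ count (x ∷ ys)
  count-cong-∷ x le with P? x
  ... | yes _ = s≤s le
  ... | no  _ = le

  count-++ : ∀ xs ys → count (xs ++ ys) ≡ count xs + count ys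
  count-++ xs ys = trans (cong length (filter-++ P? xs ys)) (length-++ (filter P? xs))

  count-↭ : ∀ {xs ys} → xs ↭ ys → count xs ≡ count ys
  count-↭ e = ↭-length (filter-↭ P? e)

  count-none : ∀ {xs} → All (¬_ ∘ P) xs → count xs ≡ 0
  count-none none = cong length (filter-none P? none)

  count≤length : ∀ xs → count xs ≤ length xs
  count≤length = length-filter P?

  count-witness : ∀ xs → 0 < count xs → ∃[ x ] x ∈ xs × P x
  count-witness xs pos with filter P? xs in eq
  ... | x ∷ _ = x , ∈-filter⁻ P? (subst (x ∈_) (sym eq) (here refl))

module _ {a p q} {A : Set a} {P : Pred A p} {Q : Pred A q}
         (P? : Decidable P) (Q? : Decidable Q) where

  open Nat using (_≤_)

  count-mono : (∀ {x} → P x → Q x) → ∀ xs → count P? xs ≤ count Q? xs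
  count-mono P⇒Q []       = z≤n
  count-mono P⇒Q (x ∷ xs) with P? x | Q? x
  ... | yes _  | yes _  = s≤s (count-mono P⇒Q xs)
  ... | yes px | no ¬qx = contradiction (P⇒Q px) ¬qx
  ... | no  _  | yes _  = m≤n⇒m≤1+n (count-mono P⇒Q xs)
  ... | no  _  | no  _  = count-mono P⇒Q xs

  count-filter : ∀ xs → count P? (filter Q? xs) ≤ count (λ x → P? x ×-dec Q? x) xs
  count-filter []       = z≤n
  count-filter (x ∷ xs) with P? x in eq | Q? x
  ... | yes _ | yes _ rewrite eq = s≤s (count-filter xs)
  ... | no  _ | yes _ rewrite eq = count-filter xs
  ... | yes _ | no  _ = count-filter xs
  ... | no  _ | no  _ = count-filter xs

-- Ordered-field arithmetic, up to division by two.

module FieldProperties {c ℓ₁ ℓ₂} (F : OrderedField c ℓ₁ ℓ₂) where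
  open OrderedField F using
    ( Carrier; _≈_; _*_; 0#; 1#; -_; _⁻¹; commutativeRing; isDecTotalOrder
    ; *-nonNegative; 1≉0; *-inverseʳ)
    renaming (_+_ to _+ᶠ_; _≤_ to _≤ᶠ_; +-monoʳ-≤ to +ᶠ-monoʳ-≤)
  module R = CommutativeRing commutativeRing
  open RingProperties R.ring using (-‿distribʳ-*; -‿distribˡ-*; -‿involutive)
  open IsDecTotalOrder isDecTotalOrder using (isPartialOrder; antisym; total)

  poset : Poset c ℓ₁ ℓ₂
  poset = record { isPartialOrder = isPartialOrder }

  open PosetReasoning poset

  2# : Carrier
  2# = 1# +ᶠ 1#

  +ᶠ-mono-≤ : ∀ {w x y z} → w ≤ᶠ x → y ≤ᶠ z → w +ᶠ y ≤ᶠ x +ᶠ z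
  +ᶠ-mono-≤ {w} {x} {y} {z} w≤x y≤z = begin
    w +ᶠ y  ≤⟨ +ᶠ-monoʳ-≤ w y≤z ⟩
    w +ᶠ z  ≈⟨ R.+-comm w z ⟩
    z +ᶠ w  ≤⟨ +ᶠ-monoʳ-≤ z w≤x ⟩
    z +ᶠ x  ≈⟨ R.+-comm z x ⟩
    x +ᶠ z  ∎

  ≤0⇒0≤- : ∀ {x} → x ≤ᶠ 0# → 0# ≤ᶠ - x
  ≤0⇒0≤- {x} x≤0 = begin
    0#         ≈⟨ R.sym (R.-‿inverseˡ x) ⟩
    - x +ᶠ x   ≤⟨ +ᶠ-monoʳ-≤ (- x) x≤0 ⟩
    - x +ᶠ 0#  ≈⟨ R.+-identityʳ (- x) ⟩
    - x        ∎

  0≤-⇒≤0 : ∀ {x} → 0# ≤ᶠ - x → x ≤ᶠ 0#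
  0≤-⇒≤0 {x} 0≤-x = begin
    x         ≈⟨ R.sym (R.+-identityʳ x) ⟩
    x +ᶠ 0#   ≤⟨ +ᶠ-monoʳ-≤ x 0≤-x ⟩
    x +ᶠ - x  ≈⟨ R.-‿inverseʳ x ⟩
    0#        ∎

  -- If `1#` were at most `0#`, then `- 1#` would be non-negative, and its square is `1#`.
  0≤1 : 0# ≤ᶠ 1#
  0≤1 with total 0# 1#
  ... | inj₁ le = le
  ... | inj₂ le = begin
    0#           ≤⟨ *-nonNegative (≤0⇒0≤- le) (≤0⇒0≤- le) ⟩
    - 1# * - 1#  ≈⟨ R.sym (-‿distribˡ-* 1# (- 1#)) ⟩
    - (1# * - 1#) ≈⟨ R.-‿cong (R.*-identityˡ (- 1#)) ⟩
    - - 1#       ≈⟨ -‿involutive 1# ⟩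
    1#           ∎

  1≤2 : 1# ≤ᶠ 2#
  1≤2 = begin
    1#        ≈⟨ R.sym (R.+-identityʳ 1#) ⟩
    1# +ᶠ 0#  ≤⟨ +ᶠ-monoʳ-≤ 1# 0≤1 ⟩
    2#        ∎

  0≤2 : 0# ≤ᶠ 2#
  0≤2 = begin
    0#  ≤⟨ 0≤1 ⟩
    1#  ≤⟨ 1≤2 ⟩
    2#  ∎

  2≉0 : ¬ 2# ≈ 0#
  2≉0 2≈0 = 1≉0 (antisym (begin 1# ≤⟨ 1≤2 ⟩ 2# ≈⟨ 2≈0 ⟩ 0# ∎) 0≤1)

  -- If `2# ⁻¹` were at most zero, then `2# * - (2# ⁻¹)`, which equals `- 1#`, would be
  -- non-negative, forcing `1# ≈ 0#`.
  0≤2⁻¹ : 0# ≤ᶠ 2# ⁻¹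
  0≤2⁻¹ with total 0# (2# ⁻¹)
  ... | inj₁ le = le
  ... | inj₂ le = contradiction (antisym 1≤0 0≤1) 1≉0
    where
    1≤0 : 1# ≤ᶠ 0#
    1≤0 = 0≤-⇒≤0 (begin
      0#             ≤⟨ *-nonNegative 0≤2 (≤0⇒0≤- le) ⟩
      2# * - (2# ⁻¹) ≈⟨ R.sym (-‿distribʳ-* 2# (2# ⁻¹)) ⟩
      - (2# * 2# ⁻¹) ≈⟨ R.-‿cong (*-inverseʳ 2# 2≉0) ⟩
      - 1#           ∎)

  *ᶠ-monoʳ-≤ : ∀ {z x y} → 0# ≤ᶠ z → x ≤ᶠ y → z * x ≤ᶠ z * y
  *ᶠ-monoʳ-≤ {z} {x} {y} 0≤z x≤y = begin
    z * x                      ≈⟨ R.sym (R.+-identityʳ (z * x)) ⟩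
    z * x +ᶠ 0#                ≤⟨ +ᶠ-monoʳ-≤ (z * x) (*-nonNegative 0≤z 0≤y-x) ⟩
    z * x +ᶠ z * (- x +ᶠ y)    ≈⟨ R.sym (R.distribˡ z x (- x +ᶠ y)) ⟩
    z * (x +ᶠ (- x +ᶠ y))      ≈⟨ R.*-congˡ (R.sym (R.+-assoc x (- x) y)) ⟩
    z * (x +ᶠ - x +ᶠ y)        ≈⟨ R.*-congˡ (R.+-congʳ (R.-‿inverseʳ x)) ⟩
    z * (0# +ᶠ y)              ≈⟨ R.*-congˡ (R.+-identityˡ y) ⟩
    z * y                      ∎
    where
    0≤y-x : 0# ≤ᶠ - x +ᶠ y
    0≤y-x = begin
      0#        ≈⟨ R.sym (R.-‿inverseˡ x) ⟩
      - x +ᶠ x  ≤⟨ +ᶠ-monoʳ-≤ (- x) x≤y ⟩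
      - x +ᶠ y  ∎

  -- Brings a bound by twice a throughput into the form in which competitiveness is stated.
  halve : ∀ {x y} → x ≤ᶠ y +ᶠ y → 2# ⁻¹ * x ≤ᶠ y
  halve {x} {y} x≤2y = begin
    2# ⁻¹ * x              ≤⟨ *ᶠ-monoʳ-≤ 0≤2⁻¹ x≤2y ⟩
    2# ⁻¹ * (y +ᶠ y)       ≈⟨ R.*-congˡ (R.sym (R.+-cong (R.*-identityˡ y) (R.*-identityˡ y))) ⟩
    2# ⁻¹ * (1# * y +ᶠ 1# * y) ≈⟨ R.*-congˡ (R.sym (R.distribʳ y 1# 1#)) ⟩
    2# ⁻¹ * (2# * y)       ≈⟨ R.sym (R.*-assoc (2# ⁻¹) 2# y) ⟩
    2# ⁻¹ * 2# * y         ≈⟨ R.*-congʳ (R.trans (R.*-comm (2# ⁻¹) 2#) (*-inverseʳ 2# 2≉0)) ⟩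
    1# * y                 ≈⟨ R.*-identityˡ y ⟩
    y                      ∎

-- Rank order, the greedy provisional schedule and its feasibility.

module Analysis {c ℓ₁ ℓ₂ r} (F : OrderedField c ℓ₁ ℓ₂)
                (priority : BoundedBuffer.Priority F r) where

  open Nat using (_+_; _≤_)
  open OrderedField F using (Carrier) renaming (_≤_ to _≤ᶠ_)
  open BoundedBuffer F
  module ≤ᶠ = IsDecTotalOrder (OrderedField.isDecTotalOrder F)
  open Priority priority using (_≼_; ≼⇒value≥; decTotalOrder)
  module ≼ = IsDecTotalOrder (Priority.isDecTotalOrder priority)
  open Sort decTotalOrder using (sort; sort-↭; sort-↗)

  Descending : List Packet → Set _
  Descending = AllPairs _≼_

  sort-descending : ∀ ps → Descending (sort ps)
  sort-descending ps =
    Sorted.Sorted⇒AllPairs (DecTotalOrder.totalOrder decTotalOrder) (sort-↗ ps)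

  -- Used to find the kept packets, in rank order, inside the sorted merge of kept and new packets.
  ↭-sublist : ∀ {xs ys : List Packet} zs → zs ↭ xs ++ ys →
              ∃[ xs′ ] xs′ ⊆ zs × xs′ ↭ xs
  ↭-sublist {[]}     []       e = [] , [] , ↭-refl
  ↭-sublist {x ∷ xs} []       e with ↭-length e
  ... | ()
  ↭-sublist {xs} {ys} (z ∷ zs) e with ∈-++⁻ xs (∈-resp-↭ e (here refl))
  ... | inj₁ z∈xs with ∈⇒↭ z∈xs
  ...   | xs₁ , exs with ↭-sublist {xs₁} {ys} zs (drop-∷ (↭-trans e (++⁺ʳ ys exs)))
  ...     | xs′ , sub , e′ = z ∷ xs′ , refl ∷ sub , ↭-trans (↭-prep z e′) (↭-sym exs)
  ↭-sublist {xs} {ys} (z ∷ zs) e | inj₂ z∈ys with ∈⇒↭ z∈ys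
  ...   | ys₁ , eys
    with ↭-sublist {xs} {ys₁} zs (drop-∷ (↭-trans e (↭-trans (++⁺ˡ xs eys) (shift z xs ys₁))))
  ...     | xs′ , sub , e′ = xs′ , z ∷ʳ sub , e′

  -- Structurally recursive form of `placeAll` on empty slots. Occupied slots always form a prefix,
  -- so each packet is tested against one slot only, the first free one.
  fill : ∀ n → ℕ → List Packet → Slots n
  fill zero    t ps       = []
  fill (suc n) t []       = nothing ∷ fill n t []
  fill (suc n) t (p ∷ ps) with t ≤? deadline p
  ... | yes _ = just p ∷ fill n (suc t) ps
  ... | no  _ = fill (suc n) t ps

  placeAll-[] : ∀ t ps → placeAll t ps [] ≡ []
  placeAll-[] t []       = refl
  placeAll-[] t (p ∷ ps) = placeAll-[] t ps

  placeAll-just : ∀ {n} t ps q (ss : Slots n) →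
                  placeAll t ps (just q ∷ ss) ≡ just q ∷ placeAll (suc t) ps ss
  placeAll-just t []       q ss = refl
  placeAll-just t (p ∷ ps) q ss = placeAll-just t ps q (place (suc t) p ss)

  fill-[] : ∀ n t → fill n t [] ≡ replicate n nothing
  fill-[] zero    t = refl
  fill-[] (suc n) t = cong (nothing ∷_) (fill-[] n t)

  placeAll≡fill : ∀ n t ps → placeAll t ps (replicate n nothing) ≡ fill n t ps
  placeAll≡fill zero    t ps       = placeAll-[] t ps
  placeAll≡fill (suc n) t []       = sym (fill-[] (suc n) t)
  placeAll≡fill (suc n) t (p ∷ ps) with t ≤? deadline p
  ... | yes _ = trans (placeAll-just t ps p (replicate n nothing))
                      (cong (just p ∷_) (placeAll≡fill n (suc t) ps))
  ... | no  _ = placeAll≡fill (suc n) t ps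

  greedy : ℕ → ℕ → List Packet → List Packet
  greedy n t ps = contents (fill n t ps)

  greedy-[] : ∀ n t → greedy n t [] ≡ []
  greedy-[] n t = trans (cong contents (fill-[] n t)) (contents-empty n)

  greedy-All : ∀ {q} {Q : Pred Packet q} n t {ps} → All Q ps → All Q (greedy n t ps)
  greedy-All zero    t qs = []
  greedy-All (suc n) t {[]}     []       = greedy-All n t []
  greedy-All (suc n) t {p ∷ ps} (q ∷ qs) with t ≤? deadline p
  ... | yes _ = q ∷ greedy-All n (suc t) qs
  ... | no  _ = greedy-All (suc n) t qs

  -- Sending the packets in the order of ≼ from step t + 1 on meets every
  -- deadline.  Equally ranked packets have equal deadlines, so the last of them
  -- decides, which makes this independent of the order in the list.
  Feasible : ℕ → List Packet → Set _
  Feasible t ps = All (λ a → t + count (≼._≤? a) ps ≤ deadline a) ps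

  Feasible-↭ : ∀ {t ps qs} → ps ↭ qs → Feasible t ps → Feasible t qs
  Feasible-↭ {t} e f =
    All.map (λ {a} → subst (λ k → t + k ≤ deadline a) (count-↭ (≼._≤? a) e)) (All-resp-↭ e f)

  -- A new first packet takes one slot, which the later start of `ps` has already allowed for. Only
  -- the bound for `p` itself depends on ties.
  Feasible-∷ : ∀ {t p ps} → All (p ≼_) ps → suc t ≤ deadline p →
               Feasible (suc t) ps → Feasible t (p ∷ ps)
  Feasible-∷ {t} {p} {ps} p≼ t<d f = head ∷ All.tabulate tail
    where
    open ≤-Reasoning
    tail : ∀ {a} → a ∈ ps → t + count (≼._≤? a) (p ∷ ps) ≤ deadline a
    tail {a} a∈ = begin
      t + count (≼._≤? a) (p ∷ ps)   ≤⟨ +-monoʳ-≤ t (count-∷-≤ (≼._≤? a) p ps) ⟩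
      t + suc (count (≼._≤? a) ps)   ≡⟨ +-suc t _ ⟩
      suc t + count (≼._≤? a) ps     ≤⟨ All.lookup f a∈ ⟩
      deadline a                     ∎

    head : t + count (≼._≤? p) (p ∷ ps) ≤ deadline p
    head with count (≼._≤? p) ps in eq
    ... | zero = begin
      t + count (≼._≤? p) (p ∷ ps)   ≤⟨ +-monoʳ-≤ t (count-∷-≤ (≼._≤? p) p ps) ⟩
      t + suc (count (≼._≤? p) ps)   ≡⟨ cong (λ k → t + suc k) eq ⟩
      t + 1                          ≡⟨ +-comm t 1 ⟩
      suc t                          ≤⟨ t<d ⟩
      deadline p                     ∎
    -- Some `b` of `ps` ranks both before and after `p`, hence ties with it. The two then have the
    -- same deadline, and the bound for `b` carries over.
    ... | suc k with count-witness (≼._≤? p) ps (subst (0 <_) (sym eq) (s≤s z≤n))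
    ...   | b , b∈ , b≼p = begin
      t + count (≼._≤? p) (p ∷ ps)   ≤⟨ +-monoʳ-≤ t (count-mono (≼._≤? p) (≼._≤? b)
                                          (λ x≼p → ≼.trans x≼p p≼b) (p ∷ ps)) ⟩
      t + count (≼._≤? b) (p ∷ ps)   ≤⟨ tail b∈ ⟩
      deadline b                     ≡⟨ proj₁ (proj₂ (≼.antisym b≼p p≼b)) ⟩
      deadline p                     ∎
      where p≼b = All.lookup p≼ b∈

  Feasible-tail : ∀ {t p ps} → All (p ≼_) ps → Feasible t (p ∷ ps) → Feasible (suc t) ps
  Feasible-tail {t} {p} {ps} p≼ (_ ∷ f) = All.zipWith step (p≼ , f)
    where
    open ≤-Reasoning
    step : ∀ {a} → p ≼ a × t + count (≼._≤? a) (p ∷ ps) ≤ deadline a →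
           suc t + count (≼._≤? a) ps ≤ deadline a
    step {a} (p≼a , fa) = begin
      suc t + count (≼._≤? a) ps     ≡⟨ sym (+-suc t _) ⟩
      t + suc (count (≼._≤? a) ps)   ≡⟨ cong (t +_) (sym (count-accept (≼._≤? a) p≼a)) ⟩
      t + count (≼._≤? a) (p ∷ ps)   ≤⟨ fa ⟩
      deadline a                     ∎

  Feasible-head : ∀ {t p ps} → Feasible t (p ∷ ps) → suc t ≤ deadline p
  Feasible-head {t} {p} {ps} (fp ∷ _) = begin
    suc t                          ≡⟨ +-comm 1 t ⟩
    t + 1                          ≤⟨ +-monoʳ-≤ t (s≤s z≤n) ⟩
    t + suc (count (≼._≤? p) ps)   ≡⟨ cong (t +_) (sym (count-accept (≼._≤? p) ≼.refl)) ⟩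
    t + count (≼._≤? p) (p ∷ ps)   ≤⟨ fp ⟩
    deadline p                     ∎
    where open ≤-Reasoning

  -- Slots are filled in rank order, and each placed packet passes the deadline test at its own
  -- slot.
  greedy-feasible : ∀ n t {ps} → Descending ps → Feasible t (greedy n (suc t) ps)
  greedy-feasible zero    t             desc = []
  greedy-feasible (suc n) t {[]}        desc = subst (Feasible t) (sym (greedy-[] n (suc t))) []
  greedy-feasible (suc n) t {p ∷ ps} (p≼ ∷ desc) with suc t ≤? deadline p
  ... | yes t<d = Feasible-∷ (greedy-All n (2 + t) p≼) t<d (greedy-feasible n (suc t) desc)
  ... | no  _   = greedy-feasible (suc n) t desc

  -- Once the first slot has been sent, the others are themselves a greedy schedule starting one
  -- step later.
  rest-feasible : ∀ n t {ps} → Descending ps → Feasible (suc t) (otherSlots (fill n (suc t) ps))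
  rest-feasible zero    t             desc = []
  rest-feasible (suc n) t {[]}        desc =
    subst (Feasible (suc t)) (sym (greedy-[] n (suc t))) []
  rest-feasible (suc n) t {p ∷ ps} (p≼ ∷ desc) with suc t ≤? deadline p
  ... | yes _ = greedy-feasible n (suc t) desc
  ... | no  _ = rest-feasible (suc n) t desc

  -- Big packets in the greedy schedule.

  module Threshold (v : Carrier) where

    Big : Pred Packet _
    Big p = v ≤ᶠ value p

    big? : Decidable Big
    big? p = v ≤ᶠ.≤? value p

    Useful : ℕ → Pred Packet _
    Useful D p = Big p × D < deadline p

    useful? : ∀ D → Decidable (Useful D)
    useful? D p = big? p ×-dec D <? deadline p

    ¬Big-later : ∀ {p ps} → ¬ Big p → All (p ≼_) ps → All (¬_ ∘ Big) ps
    ¬Big-later ¬bp = All.map (λ p≼q bq → ¬bp (≤ᶠ.trans bq (≼⇒value≥ p≼q)))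

    -- The packets of o are met in the order of ps; when the first j of them
    -- have been met, at least j slots are occupied, so the next one misses its
    -- deadline only if more than j are.  Here s counts the packets of o met so
    -- far and e the surplus of occupied slots.
    greedy-dominates : ∀ n s e {o ps} → Descending ps → o ⊆ ps → Feasible s o →
                       length o ≤ n + e →
                       count big? o ≤ e + count big? (greedy n (suc (s + e)) ps)
    greedy-dominates zero s e {o} desc sub f len =
      ≤-trans (count≤length big? o) (≤-trans len (m≤m+n e 0))
    greedy-dominates (suc n) s e desc [] f len = z≤n
    greedy-dominates (suc n) s e {o} {p ∷ ps} (p≼ ∷ desc) (_ ∷ʳ sub) f len
      with suc (s + e) ≤? deadline p
    ... | no  _ = greedy-dominates (suc n) s e desc sub f len
    ... | yes _ with big? p
    ...   | no ¬bp = ≤-trans (≤-reflexive (count-none big?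
                       (All-resp-⊆ sub (¬Big-later ¬bp p≼)))) z≤n
    ...   | yes bp = begin
      count big? o
        ≤⟨ greedy-dominates n s (suc e) desc sub f (≤-trans len (≤-reflexive (sym (+-suc n e)))) ⟩
      suc e + count big? (greedy n (suc (s + suc e)) ps)
        ≡⟨ cong (λ k → suc e + count big? (greedy n (suc k) ps)) (+-suc s e) ⟩
      suc e + count big? (greedy n (2 + (s + e)) ps)
        ≡⟨ sym (+-suc e _) ⟩
      e + suc (count big? (greedy n (2 + (s + e)) ps)) ∎
      where open ≤-Reasoning
    greedy-dominates (suc n) s e {p ∷ o} {p ∷ ps} (p≼ ∷ desc) (refl ∷ sub) f len
      with suc (s + e) ≤? deadline p | big? p
    ... | _ | no ¬bp = ≤-trans (≤-reflexive (count-none big?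
                         (All-resp-⊆ sub (¬Big-later ¬bp p≼)))) z≤n
    ... | yes _ | yes bp = begin
      suc (count big? o)
        ≤⟨ s≤s (greedy-dominates n (suc s) e desc sub
                  (Feasible-tail (All-resp-⊆ sub p≼) f) (≤-pred len)) ⟩
      suc (e + count big? (greedy n (2 + (s + e)) ps))
        ≡⟨ sym (+-suc e _) ⟩
      e + suc (count big? (greedy n (2 + (s + e)) ps))
        ≡⟨ cong (e +_) (sym (count-accept big? bp)) ⟩
      e + count big? (p ∷ greedy n (2 + (s + e)) ps) ∎
      where open ≤-Reasoning
    -- Without surplus the slot tested is step `suc s`, where feasibility of `o` leaves room for its
    -- first packet.
    greedy-dominates (suc n) s zero {p ∷ o} (p≼ ∷ desc) (refl ∷ sub) f len | no late | yes bp =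
      contradiction (subst (λ k → suc k ≤ deadline p) (sym (+-identityʳ s)) (Feasible-head f)) late
    -- One unit of surplus pays for the rejected packet of `o`; the slot under test stays the same.
    greedy-dominates (suc n) s (suc e) {p ∷ o} {p ∷ ps} (p≼ ∷ desc) (refl ∷ sub) f len
      | no late | yes bp = s≤s (begin
      count big? o
        ≤⟨ greedy-dominates (suc n) (suc s) e desc sub (Feasible-tail (All-resp-⊆ sub p≼) f)
             (≤-pred (≤-trans len (≤-reflexive (+-suc (suc n) e)))) ⟩
      e + count big? (greedy (suc n) (2 + (s + e)) ps)
        ≡⟨ cong (λ k → e + count big? (greedy (suc n) (suc k) ps)) (sym (+-suc s e)) ⟩
      e + count big? (greedy (suc n) (suc (s + suc e)) ps) ∎)
      where open ≤-Reasoning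

    -- Big packets come first, so the slot offered to one is at most `t` plus the number of big
    -- packets placed, hence at most `suc D`. A useful packet is due no earlier, and `room` ensures
    -- that the slots do not run out before all big packets have been considered.
    greedy-keeps-useful : ∀ n t D {ps} → Descending ps →
                          count big? (greedy n t ps) < n →
                          t + count big? (greedy n t ps) ≤ suc D →
                          count (useful? D) ps ≤ count (useful? D) (greedy n t ps)
    greedy-keeps-useful (suc n) t D {[]}     desc room t≤D = z≤n
    greedy-keeps-useful (suc n) t D {p ∷ ps} (p≼ ∷ desc) room t≤D with t ≤? deadline p
    ... | no late = ≤-trans
            (≤-reflexive (count-reject (useful? D)
              λ (_ , D<d) → late (≤-trans (m+n≤o⇒m≤o t t≤D) D<d)))
            (greedy-keeps-useful (suc n) t D desc room t≤D)
    ... | yes _ = placed (big? p)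
      where
      placed : Dec (Big p) →
               count (useful? D) (p ∷ ps) ≤ count (useful? D) (p ∷ greedy n (suc t) ps)
      placed (no ¬bp) = ≤-trans (≤-reflexive (count-none (useful? D)
        (¬bp ∘ proj₁ ∷ All.map (_∘ proj₁) (¬Big-later ¬bp p≼)))) z≤n
      placed (yes bp) = count-cong-∷ (useful? D) p
        (greedy-keeps-useful n (suc t) D desc
          (≤-pred (subst (_< suc n) (count-accept big? bp) room))
          (≤-trans (≤-reflexive (trans (sym (+-suc t _))
                     (cong (t +_) (sym (count-accept big? bp))))) t≤D))

    -- Ranking puts big packets ahead of all others: if the first slot held a packet that is not
    -- big, no later slot could hold a big one.
    first-big : ∀ n t {ps} → Descending ps → 0 < count big? (greedy n t ps) →
                ∃[ p ] firstSlot (fill n t ps) ≡ just p × Big p × t ≤ deadline p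
    first-big zero    t desc ()
    first-big (suc n) t {[]} desc pos =
      contradiction (subst (λ ps → 0 < count big? ps) (greedy-[] n t) pos) λ ()
    first-big (suc n) t {p ∷ ps} (p≼ ∷ desc) pos with t ≤? deadline p
    ... | no  _   = first-big (suc n) t desc pos
    ... | yes t≤d with big? p
    ...   | yes bp = p , refl , bp , t≤d
    ...   | no ¬bp = contradiction
              (subst (0 <_) (count-none big? (greedy-All n (suc t) (¬Big-later ¬bp p≼))) pos) λ ()

  -- Delivered packets, and buffer contents of arbitrary schedules.

  onTime : ℕ → Maybe Packet → List Packet
  onTime t m = filter (λ p → t ≤? deadline p) (fromMaybe m)

  delivered : (ℕ → Maybe Packet) → ℕ → List Packet
  delivered s zero    = []
  delivered s (suc t) = onTime (suc t) (s (suc t)) ++ delivered s t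

  module _ {B : ℕ} where

    Admit-length : ∀ {b ps b′} → Admit B b ps b′ → length b ≤ B → length b′ ≤ B
    Admit-length (done e)     l = subst (_≤ B) (↭-length e) l
    Admit-length (accept l a) _ = Admit-length a l
    Admit-length (reject a)   l = Admit-length a l
    Admit-length (drop e a)   l = Admit-length a (≤-trans (n≤1+n _) (subst (_≤ B) (↭-length e) l))

    -- Accepting moves a packet from the arrivals to the buffer; the other moves only lose packets.
    Admit-count : ∀ {p} {P : Pred Packet p} (P? : Decidable P) {b ps b′} →
                  Admit B b ps b′ → count P? b′ ≤ count P? b + count P? ps
    Admit-count P? {b} (done e) =
      ≤-trans (≤-reflexive (sym (count-↭ P? e))) (m≤m+n (count P? b) 0)
    Admit-count P? {b} (accept {p = p} {ps} _ a) = begin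
      _                                            ≤⟨ Admit-count P? a ⟩
      count P? (p ∷ b) + count P? ps               ≡⟨ cong (_+ count P? ps) (count-++ P? (p ∷ []) b) ⟩
      count P? (p ∷ []) + count P? b + count P? ps
        ≡⟨ exchange (count P? (p ∷ [])) (count P? b) (count P? ps) ⟩
      count P? b + (count P? (p ∷ []) + count P? ps)
        ≡⟨ cong (count P? b +_) (sym (count-++ P? (p ∷ []) ps)) ⟩
      count P? b + count P? (p ∷ ps)               ∎
      where
      open ≤-Reasoning
      exchange : ∀ x y z → x + y + z ≡ y + (x + z)
      exchange = solve-∀
    Admit-count P? {b} (reject {p = p} {ps} a) =
      ≤-trans (Admit-count P? a) (+-monoʳ-≤ (count P? b) (count-≤-∷ P? p ps))
    Admit-count P? {ps = ps} (drop {d = d} {p = p} e a) =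
      ≤-trans (Admit-count P? a) (+-monoˡ-≤ (count P? ps)
        (≤-trans (count-≤-∷ P? p d) (≤-reflexive (sym (count-↭ P? e)))))

  left-length : ∀ {B σ} (S : Schedule B σ) t → length (left S t) ≤ B
  buffer-length : ∀ {B σ} (S : Schedule B σ) t → length (buffer S (suc t)) ≤ B

  left-length S zero    = subst (λ ps → length ps ≤ _) (sym (start S)) z≤n
  left-length {B} S (suc t) = begin
    length (left S (suc t))
      ≤⟨ m≤n+m _ (length (fromMaybe (sent S (suc t)))) ⟩
    length (fromMaybe (sent S (suc t))) + length (left S (suc t))
      ≡⟨ sym (length-++ (fromMaybe (sent S (suc t)))) ⟩
    length (fromMaybe (sent S (suc t)) ++ left S (suc t))
      ≡⟨ sym (↭-length (send S t)) ⟩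
    length (buffer S (suc t))
      ≤⟨ buffer-length S t ⟩
    B ∎
    where open ≤-Reasoning

  buffer-length S t = Admit-length (admit S t) (left-length S t)

  -- The invariant comparing GRQ with the opponent at one threshold.

  module Comparison (v : Carrier) {B : ℕ} (σ : Instance) (opt : Schedule B σ) where
    open Threshold v
    open GRQAlgorithm B priority using (slots; rest; schedule)

    -- x and g count the big packets delivered so far by the opponent and by GRQ,
    -- os and gs are what they store.  The steps up to t + count big? gs are
    -- reserved for big packets of GRQ, so the opponent's packets due by then need
    -- no credit in advance.  A full buffer of big packets establishes the first
    -- alternative, in which the credit B covers anything the opponent stores.
    Balanced : ℕ → (x g : ℕ) (os gs : List Packet) → Set _
    Balanced t x g os gs =
      x + B ≤ g + g + count big? gs ⊎
      (∀ D → t + count big? gs ≤ D →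
         x + count (useful? D) os ≤ g + g + count (useful? D) gs)

    slots≡fill : ∀ t → slots σ (suc t) ≡ fill B (suc t) (sort (rest σ t ++ arrivals σ (suc t)))
    slots≡fill t = placeAll≡fill B (suc t) _

    schedule-feasible : ∀ t → Feasible t (rest σ t)
    schedule-feasible zero    = []
    schedule-feasible (suc t) = subst (Feasible (suc t) ∘ otherSlots) (sym (slots≡fill t))
                              (rest-feasible B t (sort-descending _))

    -- New arrivals never shorten the reserved run: the kept packets are feasible and fit into the
    -- buffer, so the greedy pass over the merged list, started without surplus, places at least as
    -- many big ones.
    arrival-big : ∀ t → count big? (rest σ t) ≤ count big? (contents (slots σ (suc t)))
    arrival-big t with ↭-sublist {rest σ t} {arrivals σ (suc t)} _ (sort-↭ _)
    ... | o , sub , e = begin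
      count big? (rest σ t)
        ≡⟨ sym (count-↭ big? e) ⟩
      count big? o
        ≤⟨ greedy-dominates B t 0 (sort-descending _) sub
             (Feasible-↭ (↭-sym e) (schedule-feasible t))
             (≤-trans (≤-reflexive (↭-length e))
               (≤-trans (left-length (schedule σ) t) (m≤m+n B 0))) ⟩
      count big? (greedy B (suc (t + 0)) (sort (rest σ t ++ arrivals σ (suc t))))
        ≡⟨ cong (λ k → count big? (greedy B (suc k) (sort (rest σ t ++ arrivals σ (suc t)))))
             (+-identityʳ t) ⟩
      count big? (greedy B (suc t) (sort (rest σ t ++ arrivals σ (suc t))))
        ≡⟨ cong (count big? ∘ contents) (sym (slots≡fill t)) ⟩
      count big? (contents (slots σ (suc t))) ∎
      where open ≤-Reasoning

    arrival-useful : ∀ t D → count big? (contents (slots σ (suc t))) < B →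
                     t + count big? (contents (slots σ (suc t))) ≤ D →
                     count (useful? D) (rest σ t) + count (useful? D) (arrivals σ (suc t)) ≤
                     count (useful? D) (contents (slots σ (suc t)))
    arrival-useful t D room t≤D rewrite slots≡fill t = begin
      count (useful? D) (rest σ t) + count (useful? D) (arrivals σ (suc t))
        ≡⟨ sym (count-++ (useful? D) (rest σ t) _) ⟩
      count (useful? D) (rest σ t ++ arrivals σ (suc t))
        ≡⟨ sym (count-↭ (useful? D) (sort-↭ _)) ⟩
      count (useful? D) (sort (rest σ t ++ arrivals σ (suc t)))
        ≤⟨ greedy-keeps-useful B (suc t) D (sort-descending _) room (s≤s t≤D) ⟩
      count (useful? D) (greedy B (suc t) (sort (rest σ t ++ arrivals σ (suc t)))) ∎
      where open ≤-Reasoning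

    sent-big : ∀ t → 0 < count big? (contents (slots σ (suc t))) →
               ∃[ p ] firstSlot (slots σ (suc t)) ≡ just p × Big p × suc t ≤ deadline p
    sent-big t pos rewrite slots≡fill t = first-big B (suc t) (sort-descending _) pos

    -- If GRQ's buffer is not full of big packets, it keeps every useful arrival, which matches
    -- whatever the opponent accepts. If it is full, the first alternative holds from then on until
    -- the run ends.
    arrival-balanced : ∀ t {x g} → x ≤ g + g →
                       Balanced t x g (left opt t) (rest σ t) →
                       Balanced t x g (buffer opt (suc t)) (contents (slots σ (suc t)))
    arrival-balanced t {x} {g} x≤2g (inj₁ b) =
      inj₁ (≤-trans b (+-monoʳ-≤ (g + g) (arrival-big t)))
    arrival-balanced t {x} {g} x≤2g (inj₂ b)
      with count big? (contents (slots σ (suc t))) <? B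
    ... | no full = inj₁ (+-mono-≤ x≤2g (≮⇒≥ full))
    ... | yes room = inj₂ λ D t≤D → begin
      x + count (useful? D) (buffer opt (suc t))
        ≤⟨ +-monoʳ-≤ x (Admit-count (useful? D) (admit opt t)) ⟩
      x + (count (useful? D) (left opt t) + count (useful? D) (arrivals σ (suc t)))
        ≡⟨ sym (+-assoc x _ _) ⟩
      x + count (useful? D) (left opt t) + count (useful? D) (arrivals σ (suc t))
        -- The old reserved run ends no later than the new one, so the old bound applies to this
        -- `D`.
        ≤⟨ +-monoˡ-≤ _ (b D (≤-trans (+-monoʳ-≤ t (arrival-big t)) t≤D)) ⟩
      g + g + count (useful? D) (rest σ t) + count (useful? D) (arrivals σ (suc t))
        ≡⟨ +-assoc (g + g) _ _ ⟩
      g + g + (count (useful? D) (rest σ t) + count (useful? D) (arrivals σ (suc t)))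
        ≤⟨ +-monoʳ-≤ (g + g) (arrival-useful t D room t≤D) ⟩
      g + g + count (useful? D) (contents (slots σ (suc t))) ∎
      where open ≤-Reasoning

    optHits grqHits : ℕ → ℕ
    optHits t = count big? (onTime t (sent opt t))
    grqHits t = count big? (onTime t (firstSlot (slots σ t)))

    optHits≤1 : ∀ t → optHits t ≤ 1
    optHits≤1 t = ≤-trans (count≤length big? (onTime t (sent opt t)))
      (≤-trans (length-filter (λ p → t ≤? deadline p) (fromMaybe (sent opt t))) (single (sent opt t)))
      where
      single : ∀ (m : Maybe Packet) → length (fromMaybe m) ≤ 1
      single (just _) = ≤-refl
      single nothing  = z≤n

    onTime-useful : ∀ t m → count big? (onTime (suc t) m) ≤ count (useful? t) (fromMaybe m)
    onTime-useful t m = count-filter big? (λ p → t <? deadline p) (fromMaybe m)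

    -- A packet delivered on time in step `suc t` is due after `t`, so it and the useful packets
    -- left behind are disjoint parts of the useful buffer content.
    send-useful : ∀ t {D} → t ≤ D →
                  optHits (suc t) + count (useful? D) (left opt (suc t)) ≤
                  count (useful? t) (buffer opt (suc t))
    send-useful t {D} t≤D = begin
      optHits (suc t) + count (useful? D) (left opt (suc t))
        ≤⟨ +-mono-≤ (onTime-useful t (sent opt (suc t)))
             (count-mono (useful? D) (useful? t) (λ (b , D<d) → b , ≤-<-trans t≤D D<d) (left opt (suc t))) ⟩
      count (useful? t) (fromMaybe (sent opt (suc t))) + count (useful? t) (left opt (suc t))
        ≡⟨ sym (count-++ (useful? t) (fromMaybe (sent opt (suc t))) _) ⟩
      count (useful? t) (fromMaybe (sent opt (suc t)) ++ left opt (suc t))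
        ≡⟨ sym (count-↭ (useful? t) (send opt t)) ⟩
      count (useful? t) (buffer opt (suc t)) ∎
      where open ≤-Reasoning

    left≤buffer : ∀ {p} {P : Pred Packet p} (P? : Decidable P) t →
                  count P? (left opt (suc t)) ≤ count P? (buffer opt (suc t))
    left≤buffer P? t = begin
      count P? (left opt (suc t))
        ≤⟨ m≤n+m _ _ ⟩
      count P? (fromMaybe (sent opt (suc t))) + count P? (left opt (suc t))
        ≡⟨ sym (count-++ P? (fromMaybe (sent opt (suc t))) _) ⟩
      count P? (fromMaybe (sent opt (suc t)) ++ left opt (suc t))
        ≡⟨ sym (count-↭ P? (send opt t)) ⟩
      count P? (buffer opt (suc t)) ∎
      where open ≤-Reasoning

    -- The run is over, so the credit accumulated in `g + g` must cover everything the opponent has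
    -- delivered and may still deliver after `D`.
    send-idle : ∀ t {x g} → count big? (contents (slots σ (suc t))) ≡ 0 →
                Balanced t x g (buffer opt (suc t)) (contents (slots σ (suc t))) →
                ∀ D → t ≤ D →
                optHits (suc t) + x + count (useful? D) (left opt (suc t)) ≤ g + g
    send-idle t {x} {g} none b D t≤D = begin
      optHits (suc t) + x + count (useful? D) (left opt (suc t))
        ≡⟨ exchange (optHits (suc t)) x _ ⟩
      x + (optHits (suc t) + count (useful? D) (left opt (suc t)))
        ≤⟨ +-monoʳ-≤ x (send-useful t t≤D) ⟩
      x + count (useful? t) (buffer opt (suc t))
        ≤⟨ bound b ⟩
      g + g + count big? (contents (slots σ (suc t)))
        ≡⟨ cong (g + g +_) none ⟩
      g + g + 0
        ≡⟨ +-identityʳ (g + g) ⟩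
      g + g ∎
      where
      open ≤-Reasoning
      exchange : ∀ x y z → x + y + z ≡ y + (x + z)
      exchange = solve-∀

      bound : Balanced t x g (buffer opt (suc t)) (contents (slots σ (suc t))) →
              x + count (useful? t) (buffer opt (suc t)) ≤
              g + g + count big? (contents (slots σ (suc t)))
      -- The credit `B` covers any content of the opponent's buffer.
      bound (inj₁ b) = ≤-trans
        (+-monoʳ-≤ x (≤-trans (count≤length (useful? t) (buffer opt (suc t))) (buffer-length opt t))) b
      -- With no step reserved, `t` itself is an admissible choice of `D`.
      bound (inj₂ b) = ≤-trans
        (b t (≤-reflexive (trans (cong (t +_) none) (+-identityʳ t))))
        (+-monoʳ-≤ (g + g) (count-mono (useful? t) big? proj₁ (contents (slots σ (suc t)))))

    grqHits≡1 : ∀ t {p} → firstSlot (slots σ (suc t)) ≡ just p → Big p → suc t ≤ deadline p →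
                grqHits (suc t) ≡ 1
    grqHits≡1 t first bp t<d = trans (cong (count big? ∘ onTime (suc t)) first)
      (trans (cong (count big?) (filter-accept (λ p → suc t ≤? deadline p) t<d))
             (count-accept big? bp))

    -- GRQ's delivery raises `g + g` by two: one unit pays for the opponent's delivery in the same
    -- step, the other for the big packet leaving GRQ's buffer.
    send-busy : ∀ t {x g p} → firstSlot (slots σ (suc t)) ≡ just p → Big p → suc t ≤ deadline p →
                x ≤ g + g →
                Balanced t x g (buffer opt (suc t)) (contents (slots σ (suc t))) →
                let x′ = optHits (suc t) + x; g′ = grqHits (suc t) + g in
                x′ ≤ g′ + g′ × Balanced (suc t) x′ g′ (left opt (suc t)) (rest σ (suc t))
    send-busy t {x} {g} {p} first bp t<d x≤2g b
      rewrite grqHits≡1 t first bp t<d = bound , balanced b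
      where
      open ≤-Reasoning
      x′ = optHits (suc t) + x

      all≡ : contents (slots σ (suc t)) ≡ p ∷ rest σ (suc t)
      all≡ = trans (contents-first (slots σ (suc t)))
               (cong (λ m → fromMaybe m ++ rest σ (suc t)) first)

      big≡ : count big? (contents (slots σ (suc t))) ≡ suc (count big? (rest σ (suc t)))
      big≡ = trans (cong (count big?) all≡) (count-accept big? bp)

      double : ∀ g k → suc (g + g + suc k) ≡ suc g + suc g + k
      double = solve-∀

      bound : x′ ≤ suc g + suc g
      bound = begin
        x′                 ≤⟨ +-mono-≤ (optHits≤1 (suc t)) x≤2g ⟩
        suc (g + g)        ≤⟨ n≤1+n _ ⟩
        suc (suc (g + g))  ≡⟨ cong suc (sym (+-suc g g)) ⟩
        suc g + suc g      ∎

      balanced : Balanced t x g (buffer opt (suc t)) (contents (slots σ (suc t))) →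
                 Balanced (suc t) x′ (suc g) (left opt (suc t)) (rest σ (suc t))
      balanced (inj₁ b) = inj₁ (begin
        x′ + B                                         ≡⟨ +-assoc (optHits (suc t)) x B ⟩
        optHits (suc t) + (x + B)                      ≤⟨ +-mono-≤ (optHits≤1 (suc t)) b ⟩
        suc (g + g + count big? (contents (slots σ (suc t))))
          ≡⟨ cong (λ k → suc (g + g + k)) big≡ ⟩
        suc (g + g + suc (count big? (rest σ (suc t))))  ≡⟨ double g _ ⟩
        suc g + suc g + count big? (rest σ (suc t))    ∎)
      balanced (inj₂ b) = inj₂ λ D t≤D → begin
        x′ + count (useful? D) (left opt (suc t))
          ≤⟨ +-monoʳ-≤ x′ (left≤buffer (useful? D) t) ⟩
        x′ + count (useful? D) (buffer opt (suc t))
          ≡⟨ +-assoc (optHits (suc t)) x _ ⟩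
        optHits (suc t) + (x + count (useful? D) (buffer opt (suc t)))
          -- The end of the reserved run does not move: the clock advances by one while one big
          -- packet leaves.
          ≤⟨ +-mono-≤ (optHits≤1 (suc t))
               (b D (≤-trans (≤-reflexive (trans (cong (t +_) big≡) (+-suc t _))) t≤D)) ⟩
        suc (g + g + count (useful? D) (contents (slots σ (suc t))))
          ≡⟨ cong (λ ps → suc (g + g + count (useful? D) ps)) all≡ ⟩
        suc (g + g + count (useful? D) (p ∷ rest σ (suc t)))
          ≤⟨ s≤s (+-monoʳ-≤ (g + g) (count-∷-≤ (useful? D) p _)) ⟩
        suc (g + g + suc (count (useful? D) (rest σ (suc t))))
          ≡⟨ double g _ ⟩
        suc g + suc g + count (useful? D) (rest σ (suc t)) ∎

    -- A step in which GRQ stores no big packet closes the account: whichever alternative held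
    -- before, the second one holds afterwards.
    send-balanced : ∀ t {x g} → x ≤ g + g →
                    Balanced t x g (buffer opt (suc t)) (contents (slots σ (suc t))) →
                    let x′ = optHits (suc t) + x; g′ = grqHits (suc t) + g in
                    x′ ≤ g′ + g′ × Balanced (suc t) x′ g′ (left opt (suc t)) (rest σ (suc t))
    send-balanced t {x} {g} x≤2g b = go _ refl
      where
      x′ = optHits (suc t) + x
      g′ = grqHits (suc t) + g

      go : ∀ k → count big? (contents (slots σ (suc t))) ≡ k →
           x′ ≤ g′ + g′ × Balanced (suc t) x′ g′ (left opt (suc t)) (rest σ (suc t))
      go zero none = ≤-trans (≤-trans (m≤m+n x′ _) (idle t ≤-refl)) g≤g′ ,
        inj₂ λ D t≤D → ≤-trans (idle D (≤-trans (n≤1+n t) (m+n≤o⇒m≤o (suc t) t≤D)))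
                               (≤-trans g≤g′ (m≤m+n _ _))
        where
        idle = send-idle t {x} {g} none b
        g≤g′ = +-mono-≤ (m≤n+m g (grqHits (suc t))) (m≤n+m g (grqHits (suc t)))
      go (suc k) some with sent-big t (subst (0 <_) (sym some) (s≤s z≤n))
      ... | p , first , bp , t<d = send-busy t {x} {g} first bp t<d x≤2g b

    optCount grqCount : ℕ → ℕ
    optCount t = count big? (delivered (sent opt) t)
    grqCount t = count big? (delivered (sent (schedule σ)) t)

    balanced : ∀ t → optCount t ≤ grqCount t + grqCount t ×
                     Balanced t (optCount t) (grqCount t) (left opt t) (rest σ t)
    balanced zero = z≤n , inj₂ λ D _ →
      ≤-reflexive (cong (count (useful? D)) (start opt))
    balanced (suc t) with balanced t
    ... | le , b
      rewrite count-++ big? (onTime (suc t) (sent opt (suc t))) (delivered (sent opt) t)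
            | count-++ big? (onTime (suc t) (firstSlot (slots σ (suc t))))
                            (delivered (sent (schedule σ)) t)
      = send-balanced t {optCount t} {grqCount t} le
          (arrival-balanced t {optCount t} {grqCount t} le b)


  -- From counts at every threshold to total values.

  open FieldProperties F using (+ᶠ-mono-≤; halve; poset)
  open OrderedField F using (_≈_; 0#; 1#; commutativeRing) renaming (_+_ to _+ᶠ_)
  module R = CommutativeRing commutativeRing

  total : List Packet → Carrier
  total = foldr (λ p s → value p +ᶠ s) 0#

  total≥0 : ∀ ps → 0# ≤ᶠ total ps
  total≥0 []       = ≤ᶠ.refl
  total≥0 (p ∷ ps) = ≤ᶠ.trans (≤ᶠ.reflexive (R.sym (R.+-identityʳ 0#)))
                              (+ᶠ-mono-≤ (value≥0 p) (total≥0 ps))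

  total-++ : ∀ ps qs → total (ps ++ qs) ≈ total ps +ᶠ total qs
  total-++ []       qs = R.sym (R.+-identityˡ _)
  total-++ (p ∷ ps) qs = R.trans (R.+-congˡ (total-++ ps qs)) (R.sym (R.+-assoc _ _ _))

  total-↭ : ∀ {ps qs} → ps ↭ qs → total ps ≈ total qs
  total-↭ refl-↭        = R.refl
  total-↭ (prep p e)    = R.+-congˡ (total-↭ e)
  total-↭ (swap p q e)  = R.trans (R.sym (R.+-assoc _ _ _))
    (R.trans (R.+-cong (R.+-comm _ _) (total-↭ e)) (R.+-assoc _ _ _))
  total-↭ (trans-↭ e f) = R.trans (total-↭ e) (total-↭ f)

  open Threshold using (big?; ¬Big-later)

  -- At the threshold `value p` the first packet `p` counts, so `qs` has some `q` worth at least as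
  -- much. Pairing them off and removing both preserves the hypothesis at every threshold.
  total-mono-descending : ∀ {ps} qs → Descending ps →
                          (∀ v → count (big? v) ps ≤ count (big? v) qs) →
                          total ps ≤ᶠ total qs
  total-mono-descending {[]}     qs []            le = total≥0 qs
  total-mono-descending {p ∷ ps} qs (p≼ ∷ desc) le
    with count-witness (big? (value p)) qs
           (≤-trans (≤-trans (s≤s z≤n)
             (≤-reflexive (sym (count-accept (big? (value p)) {xs = ps} ≤ᶠ.refl)))) (le (value p)))
  ... | q , q∈qs , p≤q with ∈⇒↭ q∈qs
  ...   | qs′ , e = ≤ᶠ.trans (+ᶠ-mono-≤ p≤q (total-mono-descending qs′ desc le′))
                             (≤ᶠ.reflexive (R.sym (total-↭ e)))
    where
    open ≤-Reasoning
    le′ : ∀ v → count (big? v) ps ≤ count (big? v) qs′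
    le′ v with big? v p
    -- Above `value p` nothing remains on the left; otherwise `p` is counted on the left, and
    -- removing `q` costs at most one on the right.
    ... | no ¬bp = ≤-trans (≤-reflexive (count-none (big? v) (¬Big-later v ¬bp p≼))) z≤n
    ... | yes bp = ≤-pred (begin
      suc (count (big? v) ps)   ≡⟨ sym (count-accept (big? v) bp) ⟩
      count (big? v) (p ∷ ps)   ≤⟨ le v ⟩
      count (big? v) qs         ≡⟨ count-↭ (big? v) e ⟩
      count (big? v) (q ∷ qs′)  ≤⟨ count-∷-≤ (big? v) q qs′ ⟩
      suc (count (big? v) qs′)  ∎)

  total-mono : ∀ ps qs → (∀ v → count (big? v) ps ≤ count (big? v) qs) → total ps ≤ᶠ total qs
  total-mono ps qs le = ≤ᶠ.trans (≤ᶠ.reflexive (R.sym (total-↭ (sort-↭ ps))))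
    (total-mono-descending qs (sort-descending ps)
      (λ v → ≤-trans (≤-reflexive (count-↭ (big? v) (sort-↭ ps))) (le v)))

  gain≈total : ∀ t m → gain t m ≈ total (onTime t m)
  gain≈total t nothing  = R.refl
  gain≈total t (just p) with t ≤? deadline p
  ... | yes t≤d = R.trans (R.sym (R.+-identityʳ _))
          (R.reflexive (cong total (sym (filter-accept (λ p → t ≤? deadline p) {xs = []} t≤d))))
  ... | no  t≰d =
          R.reflexive (cong total (sym (filter-reject (λ p → t ≤? deadline p) {xs = []} t≰d)))

  gainUpTo≈total : ∀ s t → gainUpTo s t ≈ total (delivered s t)
  gainUpTo≈total s zero    = R.refl
  gainUpTo≈total s (suc t) = R.trans
    (R.+-cong (gainUpTo≈total s t) (gain≈total (suc t) (s (suc t))))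
    (R.trans (R.+-comm _ _) (R.sym (total-++ (onTime (suc t) (s (suc t))) (delivered s t))))

  GRQ-2-competitive : ∀ B → Competitive (1# +ᶠ 1#) (GRQ B priority)
  GRQ-2-competitive B σ opt = halve (begin
    throughput opt               ≈⟨ gainUpTo≈total (sent opt) T ⟩
    -- Listing GRQ's packets twice expresses the factor two as a plain comparison of counts.
    total xs                     ≤⟨ total-mono xs (gs ++ gs) (λ v →
                                      ≤-trans (proj₁ (Comparison.balanced v σ opt T))
                                        (≤-reflexive (sym (count-++ (big? v) gs gs)))) ⟩
    total (gs ++ gs)             ≈⟨ total-++ gs gs ⟩
    total gs +ᶠ total gs         ≈⟨ R.+-cong (R.sym grq≈) (R.sym grq≈) ⟩
    throughput grq +ᶠ throughput grq ∎)
    where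
    open PosetReasoning poset
    T = horizon σ
    grq = run (GRQ B priority) σ
    xs = delivered (sent opt) T
    gs = delivered (sent grq) T
    grq≈ = gainUpTo≈total (sent grq) T

theorem3p2 : ∀ {c ℓ₁ ℓ₂ r} (F : OrderedField c ℓ₁ ℓ₂) →
    let open OrderedField F
        open BoundedBuffer F
    in (B : ℕ) .{{_ : NonZero B}} (priority : Priority r) →
       Competitive (1# + 1#) (GRQ B priority)
theorem3p2 F B priority = Analysis.GRQ-2-competitive F priority B
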